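{- For no integer $\Delta\ge4$ is there a finite constant $C_\Delta$ such that \[ \tau_D(G)\le \mathsf{B}_{\mathrm{HY}}(G)+C_\Delta \] for every connected graph $G$ of maximum degree exactly $\Delta$. Hence there is no finite constant $C$ such that $\tau_D(G)\le \mathsf{B}_{\mathrm{HY}}(G)+C$ for every graph $G$; and the inequality $\tau_D(G)\le\lceil \mathsf{B}_{\mathrm{HY}}(G)\rceil$ does not hold for all graphs $G$, i.e. there is a graph $G$ with $\tau_D(G)>\lceil \mathsf{B}_{\mathrm{HY}}(G)\rceil$.
   Context: All graphs are finite, simple and undirected. A set $T\subseteq V(G)$ is an identifying vertex cover if $e\cap T\neq\emptyset$ for every $e\in E(G)$ and the sets $e\cap T$ ($e\in E(G)$) are pairwise distinct; $\tau_D(G)$ is the minimum cardinality of an identifying vertex cover of $G$. For a graph $G$ of order $n$, size $m$ and maximum degree $\Delta$, \[ \mathsf{B}_{\mathrm{HY}}(G)=\frac{\Delta(\Delta-1)n+2m}{\Delta^2+1}. \] -}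

module Defs where

open import Data.Bool.Base using (Bool; true; false; T)
open import Data.Bool.Properties using (T?)
open import Data.Fin.Base using (Fin)
import Data.Bool.Properties as Bool
import Data.Fin.Base as Fin
import Data.Fin.Properties as Fin
open import Data.Fin.Subset using (Subset; inside; outside; ⁅_⁆; _∪_; _∩_; Nonempty; ∣_∣)
import Data.Fin.Subset as Subset
open import Data.Fin.Subset.Properties
  using (nonempty?; ∩-identityʳ; x∈⁅x⁆; x∈p∪q⁺)
open import Data.Integer.Base using (+_)
open import Data.List.Base using (List; []; _∷_; _++_; map; filter; length; allFin; cartesianProduct)
open import Data.List.Extrema.Nat using (argmin; max; argmin-all; f[argmin]≤f[xs])
open import Data.List.Membership.Propositional using (_∈_)
open import Data.List.Membership.Propositional.Properties
  using (∈-map⁺; ∈-map⁻; ∈-filter⁺; ∈-++⁺ˡ; ∈-++⁺ʳ)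
import Data.List.Relation.Unary.All as All
open import Data.List.Relation.Unary.All.Properties using (all-filter)
open import Data.List.Relation.Unary.Any using (here)
open import Data.Nat.Base using (ℕ; zero; suc; _+_; _*_; _∸_; _^_; _≤_; NonZero)
open import Data.Product.Base using (_×_; _,_; ∃-syntax)
open import Data.Rational.Base using (ℚ; _/_)
open import Data.Sum.Base using (inj₁)
open import Data.Vec.Base using ([]; _∷_; tabulate)
open import Data.Vec.Properties using (≡-dec)
open import Relation.Binary.Construct.Closure.ReflexiveTransitive using (Star)
open import Relation.Binary.PropositionalEquality
  using (_≡_; refl; sym; subst; subst₂)
open import Relation.Nullary.Decidable using (Dec; map′; _×-dec_; _→-dec_)
open import Relation.Unary using (Decidable)

record Graph : Set where
  field
    order     : ℕ
    adj       : Fin order → Fin order → Bool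
    adj-sym   : ∀ u v → adj u v ≡ adj v u
    adj-irr   : ∀ v → adj v v ≡ false

module _ (G : Graph) where
  open Graph G

  -- A walk is a chain of adjacent vertices; the empty graph is not connected.
  Connected : Set
  Connected = NonZero order × (∀ u v → Star (λ x y → T (adj x y)) u v)

  degree : Fin order → ℕ
  degree v = ∣ tabulate (adj v) ∣

  -- The default 0 is only attained by graphs without edges.
  maxDegree : ℕ
  maxDegree = max 0 (map degree (allFin order))

  IsArc : Fin order × Fin order → Set
  IsArc (u , v) = u Fin.< v × T (adj u v)

  isArc? : Decidable IsArc
  isArc? (u , v) = (u Fin.<? v) ×-dec T? (adj u v)

  endpoints : Fin order × Fin order → Subset order
  endpoints (u , v) = ⁅ u ⁆ ∪ ⁅ v ⁆

  -- E(G) as a list of two-element vertex sets. Requiring u < v lists every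
  -- edge {u , v} exactly once.
  edges : List (Subset order)
  edges = map endpoints (filter isArc? (cartesianProduct (allFin order) (allFin order)))

  size : ℕ
  size = length edges

  record IdentifyingVertexCover (S : Subset order) : Set where
    constructor mkIVC
    field
      covers      : ∀ e → e ∈ edges → Nonempty (e ∩ S)
      identifying : ∀ e f → e ∈ edges → f ∈ edges → e ∩ S ≡ f ∩ S → e ≡ f

  identifyingVertexCover? : Decidable IdentifyingVertexCover
  identifyingVertexCover? S =
    map′ (λ (c , i) → mkIVC (λ _ p → All.lookup c p)
                            (λ _ _ p q → All.lookup (All.lookup i p) q))
         (λ (mkIVC c i) → All.tabulate (λ p → c _ p)
                        , All.tabulate (λ p → All.tabulate (λ q → i _ _ p q)))
         (All.all? (λ e → nonempty? (e ∩ S)) edges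
          ×-dec
          All.all? (λ e → All.all? (λ f → ((e ∩ S) ≟ (f ∩ S)) →-dec (e ≟ f)) edges) edges)
    where
    _≟_ : (p q : Subset order) → Dec (p ≡ q)
    _≟_ = ≡-dec Bool._≟_

allSubsets : ∀ n → List (Subset n)
allSubsets zero    = [] ∷ []
allSubsets (suc n) = map (inside ∷_) (allSubsets n) ++ map (outside ∷_) (allSubsets n)

∈-allSubsets : ∀ {n} (S : Subset n) → S ∈ allSubsets n
∈-allSubsets []           = here refl
∈-allSubsets (true  ∷ S)  = ∈-++⁺ˡ (∈-map⁺ (inside ∷_) (∈-allSubsets S))
∈-allSubsets (false ∷ S)  = ∈-++⁺ʳ _ (∈-map⁺ (outside ∷_) (∈-allSubsets S))

module _ (G : Graph) where
  open Graph G

  -- The default V(G) is harmless, since V(G) is itself an identifying vertex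
  -- cover (V-identifyingVertexCover).
  minimumIVC : Subset order
  minimumIVC = argmin ∣_∣ Subset.⊤ (filter (identifyingVertexCover? G) (allSubsets order))

  τD : ℕ
  τD = ∣ minimumIVC ∣

  V-identifyingVertexCover : IdentifyingVertexCover G Subset.⊤
  V-identifyingVertexCover = mkIVC cov idn
    where
    cov : ∀ e → e ∈ edges G → Nonempty (e ∩ Subset.⊤)
    cov e e∈ with (u , v) , _ , refl ← ∈-map⁻ (endpoints G) e∈ =
      u , subst (u Subset.∈_) (sym (∩-identityʳ e)) (x∈p∪q⁺ (inj₁ (x∈⁅x⁆ u)))
    idn : ∀ e f → e ∈ edges G → f ∈ edges G → e ∩ Subset.⊤ ≡ f ∩ Subset.⊤ → e ≡ f
    idn e f _ _ eq = subst₂ _≡_ (∩-identityʳ e) (∩-identityʳ f) eq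

  τD-attained : ∃[ S ] IdentifyingVertexCover G S × ∣ S ∣ ≡ τD
  τD-attained = minimumIVC
              , argmin-all ∣_∣ V-identifyingVertexCover
                  (all-filter (identifyingVertexCover? G) (allSubsets order))
              , refl

  τD-minimal : ∀ S → IdentifyingVertexCover G S → τD ≤ ∣ S ∣
  τD-minimal S ivc =
    All.lookup (f[argmin]≤f[xs] Subset.⊤ (filter (identifyingVertexCover? G) (allSubsets order)))
               (∈-filter⁺ (identifyingVertexCover? G) (∈-allSubsets S) ivc)

  -- For Δ = 0 the truncated subtraction Δ ∸ 1 is multiplied by Δ = 0.
  BHY : ℚ
  BHY = + (Δ * (Δ ∸ 1) * order + 2 * size G) / suc (Δ ^ 2)
    where
    Δ : ℕ
    Δ = maxDegree G

ℕ→ℚ : ℕ → ℚ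
ℕ→ℚ k = + k / 1

{-# OPTIONS --safe #-}

-- The complement of an identifying vertex cover is a set of vertices with pairwise disjoint
-- closed neighbourhoods, so it meets every set of diameter at most 2 at most once. The bound
-- reads τD ≤ n − Σ (Δ + 1 − deg v) / (Δ² + 1) + C, so it suffices to chain, by one edge each,
-- copies of a diameter-2 gadget with Σ (Δ + 1 − deg v) > Δ² + 3. For Δ = 4 + s the Petersen
-- graph with one vertex replaced by 1 + s twins does it: after linking, its 10 + s vertices have
-- degree sum 32 + 6 s, so each copy exceeds Δ² + 1 by 1 + s.
module Submission where

open import Defs
open import Data.Bool.Base using (Bool; true; false; T; not)
import Data.Bool.Properties as Bool
open import Data.Empty using (⊥-elim)
open import Data.Fin.Base using (Fin; zero; suc; toℕ; combine; remQuot; inject₁; fromℕ; _↑ˡ_; _↑ʳ_)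
open import Data.Fin.Patterns
import Data.Fin.Properties as Fin
open import Data.Fin.Properties
  using (_≟_; all?; any?; remQuot-combine; combine-remQuot; combine-injective; toℕ-injective;
    toℕ-inject₁)
open import Data.Fin.Subset using (Subset; ⁅_⁆; _∪_; _∩_; ⊥; ∣_∣)
import Data.Fin.Subset as Subset
open import Data.Fin.Subset.Properties
  using (x∈p∩q⁻; x∈p∪q⁻; x∈p∪q⁺; x∈⁅x⁆; x∈⁅y⁆⇒x≡y; ∩-distribʳ-∪; ∪-identityˡ; ∪-comm;
    Empty-unique)
import Data.Integer.Base as ℤ
import Data.Integer.DivMod as ℤ
import Data.Integer.Properties as ℤ
open import Data.List.Base using (map; filter; length; allFin; cartesianProduct; _++_)
import Data.List.Base as List
open import Data.List.Extrema.Nat using (max≤v⁺; v≤max⁺)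
open import Data.List.Membership.Propositional using (_∈_; lose)
open import Data.List.Membership.Propositional.Properties
  using (∈-map⁺; ∈-filter⁺; ∈-cartesianProduct⁺; ∈-allFin)
open import Data.List.Properties using (length-map; length-++; filter-++; map-tabulate)
import Data.List.Relation.Unary.All as All
open import Data.List.Relation.Unary.All.Properties using () renaming (map⁺ to All-map⁺)
open import Data.List.Relation.Unary.Any.Properties using () renaming (map⁺ to Any-map⁺)
open import Data.Nat.Base using (ℕ; zero; suc; _+_; _*_; _∸_; _^_; _≤_; z≤n; s≤s)
import Data.Nat.Base as ℕ
open import Data.Nat.Properties hiding (_≟_)
import Data.Nat.Properties as ℕ
open import Data.Nat.Tactic.RingSolver using (solve-∀)
open import Data.Product.Base using (_×_; _,_; ∃-syntax; Σ-syntax; proj₁; proj₂; uncurry)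
open import Data.Rational.Base using (ℚ; mkℚ; ceiling; toℚᵘ; _/_)
import Data.Rational.Base as ℚ
import Data.Rational.Properties as ℚ
import Data.Rational.Unnormalised.Base as ℚᵘ
import Data.Rational.Unnormalised.Properties as ℚᵘ
open import Data.Sum.Base using (_⊎_; inj₁; inj₂; [_,_]′; swap)
open import Data.Vec.Base using ([]; _∷_; tabulate; lookup)
import Data.Vec.Properties as Vec
open import Function.Base using (_∘_; id)
open import Level using (0ℓ)
open import Relation.Binary.Construct.Closure.ReflexiveTransitive using (Star; ε; _◅_; _◅◅_; reverse)
open import Relation.Binary.Definitions using (tri<; tri≈; tri>)
open import Relation.Binary.PropositionalEquality
open import Relation.Nullary.Decidable
  using (Dec; yes; no; ⌊_⌋; toWitness; fromWitness; from-yes; ¬?; _×-dec_; _⊎-dec_; _→-dec_)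
open import Relation.Nullary.Negation using (¬_; contradiction)
open import Relation.Unary using (Decidable; Pred)
open import Algebra.Properties.Semiring.Sum +-*-semiring
  using (sum; sum-cong-≗; ∑-distrib-+; ∑-comm; *-distribˡ-sum)

-- Counting with sums of indicators.

ι : Bool → ℕ
ι true  = 1
ι false = 0

ι≤ : ∀ {b m} → (T b → 1 ≤ m) → ι b ≤ m
ι≤ {true}  h = h _
ι≤ {false} _ = z≤n

T⇒1≤ι : ∀ {b} → T b → 1 ≤ ι b
T⇒1≤ι {true} _ = s≤s z≤n

ι-not : ∀ b → ι b + ι (not b) ≡ 1
ι-not true  = refl
ι-not false = refl

T-ext : ∀ {a b} → (T a → T b) → (T b → T a) → a ≡ b
T-ext {true}  {true}  _ _ = refl
T-ext {true}  {false} f _ = ⊥-elim (f _)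
T-ext {false} {true}  _ g = ⊥-elim (g _)
T-ext {false} {false} _ _ = refl

sum-mono : ∀ {n} {f g : Fin n → ℕ} → (∀ i → f i ≤ g i) → sum f ≤ sum g
sum-mono {zero}  h = z≤n
sum-mono {suc n} h = +-mono-≤ (h zero) (sum-mono (h ∘ suc))

sum-const : ∀ n c → sum {n} (λ _ → c) ≡ n * c
sum-const zero    c = refl
sum-const (suc n) c = cong (c +_) (sum-const n c)

term≤sum : ∀ {n} (f : Fin n → ℕ) i → f i ≤ sum f
term≤sum f zero    = m≤m+n _ _
term≤sum f (suc i) = ≤-trans (term≤sum (f ∘ suc) i) (m≤n+m _ _)

-- Turns every uniqueness statement below into a numerical bound: one link up, one link down, one
-- missing vertex per gadget. Bounding by `ι c` rather than by 1 makes the sum vanish where no index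
-- can qualify.
sum-ι≤ι : ∀ {n} (f : Fin n → Bool) {c} → (∀ i → T (f i) → T c) →
          (∀ i j → T (f i) → T (f j) → i ≡ j) → sum (ι ∘ f) ≤ ι c
sum-ι≤ι {zero}  f h u = z≤n
sum-ι≤ι {suc n} f {c} h u with f zero in eq
... | false = sum-ι≤ι (f ∘ suc) (h ∘ suc) λ i j p q → Fin.suc-injective (u _ _ p q)
... | true  = begin
  -- Since `zero` qualifies, uniqueness excludes the whole tail, so the recursive call may take `c`
  -- to be `false`.
  1 + sum (ι ∘ f ∘ suc) ≤⟨ +-monoʳ-≤ 1 (sum-ι≤ι (f ∘ suc) {false} only-zero λ i _ p _ → ⊥-elim (only-zero i p)) ⟩
  1                     ≤⟨ T⇒1≤ι (h zero f0) ⟩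
  ι c                   ∎
  where
  open ≤-Reasoning
  f0 : T (f zero)
  f0 = subst T (sym eq) _
  only-zero : ∀ i → ¬ T (f (suc i))
  only-zero i p with () ← u zero (suc i) f0 p

sum-↑ : ∀ m {n} (f : Fin (m + n) → ℕ) → sum f ≡ sum (f ∘ (_↑ˡ n)) + sum (f ∘ (m ↑ʳ_))
sum-↑ zero    f = refl
sum-↑ (suc m) f = trans (cong (f zero +_) (sum-↑ m (f ∘ suc))) (sym (+-assoc (f zero) _ _))

sum-combine : ∀ k {n} (f : Fin (k * n) → ℕ) → sum f ≡ sum {k} (λ i → sum {n} (λ a → f (combine i a)))
sum-combine zero        f = refl
sum-combine (suc k) {n} f = trans (sum-↑ n f) (cong (sum (f ∘ (_↑ˡ k * n)) +_) (sum-combine k (f ∘ (n ↑ʳ_))))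

-- After exchanging the sums, the column over a fixed `b` has its only possible hit at `j = i`. This
-- confines the inner neighbours of a vertex to its own copy.
sum-fibre : ∀ k {n} (f : Fin (k * n) → Bool) (c : Fin n → Bool) (i : Fin k) →
            (∀ j b → T (f (combine j b)) → j ≡ i × T (c b)) → sum (ι ∘ f) ≤ sum (ι ∘ c)
sum-fibre k {n} f c i h = begin
  sum (ι ∘ f)                                              ≡⟨ sum-combine k (ι ∘ f) ⟩
  sum {k} (λ j → sum {n} (λ b → ι (f (combine j b))))      ≡⟨ ∑-comm {k} {n} (λ j b → ι (f (combine j b))) ⟩
  sum {n} (λ b → sum {k} (λ j → ι (f (combine j b))))      ≤⟨ sum-mono column ⟩
  sum (ι ∘ c)                                              ∎
  where
  open ≤-Reasoning
  column : ∀ b → sum {k} (λ j → ι (f (combine j b))) ≤ ι (c b)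
  column b = sum-ι≤ι (λ j → f (combine j b)) (λ j p → proj₂ (h j b p))
    (λ j l p q → trans (proj₁ (h j b p)) (sym (proj₁ (h l b q))))

∣tabulate∣ : ∀ {n} (f : Fin n → Bool) → ∣ tabulate f ∣ ≡ sum (ι ∘ f)
∣tabulate∣ {zero}  f = refl
∣tabulate∣ {suc n} f with f zero
... | true  = cong suc (∣tabulate∣ (f ∘ suc))
... | false = ∣tabulate∣ (f ∘ suc)

length-filter-tabulate : ∀ {A : Set} {P : Pred A 0ℓ} (P? : Decidable P) {n} (f : Fin n → A) →
                         length (filter P? (List.tabulate f)) ≡ sum (λ i → ι ⌊ P? (f i) ⌋)
length-filter-tabulate P? {zero}  f = refl
length-filter-tabulate P? {suc n} f with P? (f zero)
... | yes _ = cong suc (length-filter-tabulate P? (f ∘ suc))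
... | no  _ = length-filter-tabulate P? (f ∘ suc)

length-filter-cartesianProduct :
  ∀ {A B : Set} {P : Pred (A × B) 0ℓ} (P? : Decidable P) {m n} (f : Fin m → A) (g : Fin n → B) →
  length (filter P? (cartesianProduct (List.tabulate f) (List.tabulate g)))
    ≡ sum (λ i → sum (λ j → ι ⌊ P? (f i , g j) ⌋))
length-filter-cartesianProduct P? {zero}  f g = refl
length-filter-cartesianProduct P? {suc m} f g = begin
  length (filter P? (row ++ rest))                     ≡⟨ cong length (filter-++ P? row rest) ⟩
  length (filter P? row ++ filter P? rest)             ≡⟨ length-++ (filter P? row) ⟩
  length (filter P? row) + length (filter P? rest)     ≡⟨ cong₂ _+_
    (trans (cong (length ∘ filter P?) (map-tabulate g (f zero ,_)))
      (length-filter-tabulate P? (λ j → f zero , g j)))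
    (length-filter-cartesianProduct P? (f ∘ suc) g) ⟩
  _                                                    ∎
  where
  open ≡-Reasoning
  row  = map (f zero ,_) (List.tabulate g)
  rest = cartesianProduct (List.tabulate (f ∘ suc)) (List.tabulate g)

-- Handshake bound, and the vertices outside an identifying vertex cover.

module _ (G : Graph) where
  open Graph G

  degree-sum : ∀ v → degree G v ≡ sum (ι ∘ adj v)
  degree-sum v = ∣tabulate∣ (adj v)

  arc : Fin order → Fin order → ℕ
  arc u v = ι ⌊ isArc? G (u , v) ⌋

  arc-arc≤adj : ∀ u v → arc u v + arc v u ≤ ι (adj u v)
  arc-arc≤adj u v with isArc? G (u , v) | isArc? G (v , u)
  ... | no  _       | no  _       = z≤n
  ... | no  _       | yes (_ , a) = T⇒1≤ι (subst T (adj-sym v u) a)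
  ... | yes (_ , a) | no  _       = T⇒1≤ι a
  ... | yes (p , _) | yes (q , _) = contradiction q (Fin.<-asym p)

  -- An edge is listed as one arc, from its smaller to its larger end. Adding the transposed double
  -- sum therefore counts it twice, while at most one of `(u , v)` and `(v , u)` is an arc.
  2size≤degree-sum : 2 * size G ≤ sum (degree G)
  2size≤degree-sum = begin
    2 * size G                                                 ≡⟨ cong (2 *_) size≡∑arc ⟩
    2 * ∑arc                                                   ≡⟨ cong (∑arc +_) (+-identityʳ ∑arc) ⟩
    ∑arc + ∑arc                                                ≡⟨ cong (∑arc +_) (∑-comm arc) ⟩
    ∑arc + sum (λ u → sum (λ v → arc v u))                     ≡⟨ ∑-distrib-+ (λ u → sum (arc u)) (λ u → sum (λ v → arc v u)) ⟨
    sum (λ u → sum (arc u) + sum (λ v → arc v u))              ≡⟨ sum-cong-≗ (λ u → ∑-distrib-+ (arc u) (λ v → arc v u)) ⟨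
    sum (λ u → sum (λ v → arc u v + arc v u))                  ≤⟨ sum-mono (λ u → sum-mono (arc-arc≤adj u)) ⟩
    sum (λ u → sum (ι ∘ adj u))                                ≡⟨ sum-cong-≗ degree-sum ⟨
    sum (degree G)                                             ∎
    where
    open ≤-Reasoning
    ∑arc = sum (λ u → sum (arc u))
    size≡∑arc : size G ≡ ∑arc
    size≡∑arc = trans
      (length-map (endpoints G) (filter (isArc? G) (cartesianProduct (allFin order) (allFin order))))
      (length-filter-cartesianProduct (isArc? G) id id)

  arc∈edges : ∀ {u v} → IsArc G (u , v) → ⁅ u ⁆ ∪ ⁅ v ⁆ ∈ edges G
  arc∈edges {u} {v} p = ∈-map⁺ (endpoints G) (∈-filter⁺ (isArc? G) (∈-cartesianProduct⁺ (∈-allFin u) (∈-allFin v)) p)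

  edge∈edges : ∀ u v → T (adj u v) → ⁅ u ⁆ ∪ ⁅ v ⁆ ∈ edges G
  edge∈edges u v a with Fin.<-cmp u v
  ... | tri< u<v _ _  = arc∈edges (u<v , a)
  ... | tri≈ _ refl _ = ⊥-elim (subst T (adj-irr u) a)
  ... | tri> _ _ v<u  = subst (_∈ edges G) (∪-comm ⁅ v ⁆ ⁅ u ⁆) (arc∈edges (v<u , subst T (adj-sym u v) a))

  module _ {S : Subset order} (ivc : IdentifyingVertexCover G S) where
    open IdentifyingVertexCover ivc

    uncovered-edge : ∀ {u v} → u Subset.∉ S → v Subset.∉ S → ¬ T (adj u v)
    uncovered-edge {u} {v} u∉ v∉ a
      with x , x∈ ← covers _ (edge∈edges u v a)
      with x∈e , x∈S ← x∈p∩q⁻ (⁅ u ⁆ ∪ ⁅ v ⁆) S x∈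
      with x∈p∪q⁻ ⁅ u ⁆ ⁅ v ⁆ x∈e
    ... | inj₁ x∈u = u∉ (subst (Subset._∈ S) (x∈⁅y⁆⇒x≡y u x∈u) x∈S)
    ... | inj₂ x∈v = v∉ (subst (Subset._∈ S) (x∈⁅y⁆⇒x≡y v x∈v) x∈S)

    -- An end outside `S` leaves no mark, so such an edge is seen only through its other end.
    trace : ∀ {u} w → u Subset.∉ S → (⁅ u ⁆ ∪ ⁅ w ⁆) ∩ S ≡ ⁅ w ⁆ ∩ S
    trace {u} w u∉ = begin
      (⁅ u ⁆ ∪ ⁅ w ⁆) ∩ S         ≡⟨ ∩-distribʳ-∪ S ⁅ u ⁆ ⁅ w ⁆ ⟩
      (⁅ u ⁆ ∩ S) ∪ (⁅ w ⁆ ∩ S)   ≡⟨ cong (_∪ (⁅ w ⁆ ∩ S)) (Empty-unique empty) ⟩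
      ⊥ ∪ (⁅ w ⁆ ∩ S)             ≡⟨ ∪-identityˡ _ ⟩
      ⁅ w ⁆ ∩ S                   ∎
      where
      open ≡-Reasoning
      empty : Subset.Empty (⁅ u ⁆ ∩ S)
      empty (x , x∈) with x∈u , x∈S ← x∈p∩q⁻ ⁅ u ⁆ S x∈ =
        u∉ (subst (Subset._∈ S) (x∈⁅y⁆⇒x≡y u x∈u) x∈S)

    -- The edges from `u` and `v` to `w` have the same trace, hence coincide, and `u` cannot be `w`.
    -- With `uncovered-edge` this puts distinct vertices outside `S` at distance at least 3.
    common-neighbour : ∀ {u v w} → u Subset.∉ S → v Subset.∉ S → T (adj u w) → T (adj v w) → u ≡ v
    common-neighbour {u} {v} {w} u∉ v∉ a b =
      [ x∈⁅y⁆⇒x≡y v , (λ u∈w → ⊥-elim (loop (x∈⁅y⁆⇒x≡y w u∈w))) ]′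
      (x∈p∪q⁻ ⁅ v ⁆ ⁅ w ⁆ (subst (u Subset.∈_) same-edge (x∈p∪q⁺ (inj₁ (x∈⁅x⁆ u)))))
      where
      same-edge : ⁅ u ⁆ ∪ ⁅ w ⁆ ≡ ⁅ v ⁆ ∪ ⁅ w ⁆
      same-edge = identifying _ _ (edge∈edges u w a) (edge∈edges v w b)
        (trans (trace w u∉) (sym (trace w v∉)))
      loop : u ≢ w
      loop refl = subst T (adj-irr u) a

maxDegree-≡ : ∀ G {Δ} → (∀ v → degree G v ≤ Δ) → ∀ v → Δ ≤ degree G v → maxDegree G ≡ Δ
maxDegree-≡ G deg≤Δ v Δ≤deg = ≤-antisym
  -- `z≤n` disposes of the default value 0 in `maxDegree`.
  (max≤v⁺ {xs = map (degree G) (allFin (Graph.order G))} z≤n (All-map⁺ (All.tabulate λ {u} _ → deg≤Δ u)))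
  (v≤max⁺ 0 _ (inj₂ (Any-map⁺ (lose (∈-allFin v) Δ≤deg))))

≤-τD : ∀ G {b} → (∀ S → IdentifyingVertexCover G S → b ≤ ∣ S ∣) → b ≤ τD G
≤-τD G h = h (minimumIVC G) (proj₁ (proj₂ (τD-attained G)))

-- The Petersen graph and the twinning of its last vertex.

-- The Petersen graph as the Kneser graph of the 2-subsets of a 5-set. Vertex 9 is the one
-- replaced by twins; its neighbours 0 and 1 carry the links.
label : Fin 10 → Subset 5
label = lookup
  ( ⁅ 2F ⁆ ∪ ⁅ 3F ⁆ ∷ ⁅ 2F ⁆ ∪ ⁅ 4F ⁆ ∷ ⁅ 3F ⁆ ∪ ⁅ 4F ⁆
  ∷ ⁅ 0F ⁆ ∪ ⁅ 2F ⁆ ∷ ⁅ 0F ⁆ ∪ ⁅ 3F ⁆ ∷ ⁅ 0F ⁆ ∪ ⁅ 4F ⁆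
  ∷ ⁅ 1F ⁆ ∪ ⁅ 2F ⁆ ∷ ⁅ 1F ⁆ ∪ ⁅ 3F ⁆ ∷ ⁅ 1F ⁆ ∪ ⁅ 4F ⁆
  ∷ ⁅ 0F ⁆ ∪ ⁅ 1F ⁆ ∷ [] )

Petersen : Fin 10 → Fin 10 → Set
Petersen p q = label p ∩ label q ≡ ⊥

petersen? : ∀ p q → Dec (Petersen p q)
petersen? p q = Vec.≡-dec Bool._≟_ (label p ∩ label q) ⊥

abstract

  Petersen-sym : ∀ {p q} → Petersen p q → Petersen q p
  Petersen-sym {p} {q} = from-yes (all? λ p → all? λ q → petersen? p q →-dec petersen? q p) p q

  Petersen-irr : ∀ p → ¬ Petersen p p
  Petersen-irr = from-yes (all? λ p → ¬? (petersen? p p))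

  -- Two distinct 2-subsets that meet have a union of size 3, whose complement is a common
  -- neighbour. The diagonal `p = q` is included, with any neighbour as `w`; it is the case that
  -- serves a pair of twins.
  Petersen-diameter : ∀ p q → Petersen p q ⊎ (∃[ w ] Petersen p w × Petersen q w)
  Petersen-diameter = from-yes (all? λ p → all? λ q →
    petersen? p q ⊎-dec any? λ w → petersen? p w ×-dec petersen? q w)

-- The indices from `m` on, `1 + s` in number, all go to the last vertex; the others keep their
-- value. Pulling an irreflexive adjacency back along this map replaces the last vertex by `1 + s`
-- pairwise nonadjacent twins.
collapse : ∀ m {s} → Fin (suc m + s) → Fin (suc m)
collapse zero    _       = zero
collapse (suc m) zero    = zero
collapse (suc m) (suc i) = suc (collapse m i)

collapse-↑ˡ : ∀ m s (p : Fin (suc m)) → collapse m (p ↑ˡ s) ≡ p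
collapse-↑ˡ zero    s zero    = refl
collapse-↑ˡ (suc m) s zero    = refl
collapse-↑ˡ (suc m) s (suc p) = cong suc (collapse-↑ˡ m s p)

-- The last vertex is hit `1 + s` times: once within `sum f`, and `s` times more.
sum-collapse : ∀ m s (f : Fin (suc m) → ℕ) → sum {suc m + s} (f ∘ collapse m) ≡ sum f + s * f (fromℕ m)
sum-collapse zero    s f = trans (cong (f zero +_) (sum-const s (f zero)))
  (cong (_+ s * f zero) (sym (+-identityʳ (f zero))))
sum-collapse (suc m) s f = trans (cong (f zero +_) (sum-collapse m s (f ∘ suc))) (sym (+-assoc (f zero) _ _))

-- Degrees after twinning are affine in `s`, and the sum runs over a vertex set that itself grows
-- with `s`; this is `sum-collapse` for such weights.
sum-collapse-affine : ∀ m s (f g : Fin (suc m) → ℕ) →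
  sum {suc m + s} ((λ p → f p + s * g p) ∘ collapse m) ≡ sum f + s * sum g + s * (f (fromℕ m) + s * g (fromℕ m))
sum-collapse-affine m s f g = begin
  sum {suc m + s} (h ∘ collapse m)               ≡⟨ sum-collapse m s h ⟩
  sum h + s * h (fromℕ m)                        ≡⟨ cong (_+ s * h (fromℕ m)) (∑-distrib-+ f (λ p → s * g p)) ⟩
  sum f + sum (λ p → s * g p) + s * h (fromℕ m)  ≡⟨ cong (λ z → sum f + z + s * h (fromℕ m)) (*-distribˡ-sum s g) ⟨
  sum f + s * sum g + s * h (fromℕ m)            ∎
  where
  open ≡-Reasoning
  h : Fin (suc m) → ℕ
  h p = f p + s * g p

-- A vertex of the gadget over p has at most fixed p + s * twinned p neighbours, links included.
fixed twinned : Fin 10 → ℕ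
fixed p   = sum (λ q → ι ⌊ petersen? p q ⌋) + (ι ⌊ p ≟ 0F ⌋ + ι ⌊ p ≟ 1F ⌋)
twinned p = ι ⌊ petersen? p 9F ⌋

fixed≤4 : ∀ p → fixed p ≤ 4
fixed≤4 = from-yes (all? λ p → fixed p ≤? 4)

twinned≤1 : ∀ p → twinned p ≤ 1
twinned≤1 = from-yes (all? λ p → twinned p ≤? 1)

-- Ten vertices of degree 3, plus one link at each of `0F` and `1F`.
sum-fixed : sum fixed ≡ 32
sum-fixed = refl

sum-twinned : sum twinned ≡ 3
sum-twinned = refl

fixed-9 : fixed (fromℕ 9) ≡ 3
fixed-9 = refl

twinned-9 : twinned (fromℕ 9) ≡ 0
twinned-9 = refl

-- The chain of gadgets and its connectedness.

module Chain (s k′ : ℕ) where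

  -- At least two copies, so that the hub `0F` of the first copy does carry a link and reaches
  -- degree `4 + s`.
  V k : ℕ
  V = 10 + s
  k = 2 + k′

  vertex : Fin k → Fin V → Fin (k * V)
  vertex = combine

  over : Fin V → Fin 10
  over = collapse 9

  lift : Fin 10 → Fin V
  lift = _↑ˡ s

  -- A link leaves a copy at `0F` and enters the next at `1F`. With distinct hubs for the two
  -- directions, each hub bears at most one link.
  Inner Up Adjacent : Fin k × Fin V → Fin k × Fin V → Set
  Inner (i , a) (j , b) = i ≡ j × Petersen (over a) (over b)
  Up    (i , a) (j , b) = toℕ j ≡ suc (toℕ i) × a ≡ 0F × b ≡ 1F
  Adjacent x y = Inner x y ⊎ Up x y ⊎ Up y x

  inner? : ∀ x y → Dec (Inner x y)
  inner? (i , a) (j , b) = i ≟ j ×-dec petersen? (over a) (over b)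

  up? : ∀ x y → Dec (Up x y)
  up? (i , a) (j , b) = toℕ j ℕ.≟ suc (toℕ i) ×-dec (a ≟ 0F) ×-dec (b ≟ 1F)

  adjacent? : ∀ x y → Dec (Adjacent x y)
  adjacent? x y = inner? x y ⊎-dec up? x y ⊎-dec up? y x

  Adjacent-sym : ∀ {x y} → Adjacent x y → Adjacent y x
  Adjacent-sym {_ , a} {_ , b} (inj₁ (refl , p)) = inj₁ (refl , Petersen-sym {over a} {over b} p)
  Adjacent-sym (inj₂ p)                          = inj₂ (swap p)

  Adjacent-irr : ∀ x → ¬ Adjacent x x
  Adjacent-irr (i , a) (inj₁ (_ , p))            = Petersen-irr (over a) p
  Adjacent-irr (i , a) (inj₂ (inj₁ (i≡1+i , _))) = 1+n≢n (sym i≡1+i)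
  Adjacent-irr (i , a) (inj₂ (inj₂ (i≡1+i , _))) = 1+n≢n (sym i≡1+i)

  abstract

    coords : Fin (k * V) → Fin k × Fin V
    coords = remQuot V

    coords-vertex : ∀ i a → coords (vertex i a) ≡ (i , a)
    coords-vertex = remQuot-combine

    vertex-coords : ∀ u → uncurry vertex (coords u) ≡ u
    vertex-coords = combine-remQuot {k} V

    adjacentᵇ : Fin (k * V) → Fin (k * V) → Bool
    adjacentᵇ u v = ⌊ adjacent? (coords u) (coords v) ⌋

    adjacentᵇ⁻ : ∀ u v → T (adjacentᵇ u v) → Adjacent (coords u) (coords v)
    adjacentᵇ⁻ u v = toWitness

    adjacentᵇ⁺ : ∀ u v → Adjacent (coords u) (coords v) → T (adjacentᵇ u v)
    adjacentᵇ⁺ u v = fromWitness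

  coords-injective : ∀ {u v} → coords u ≡ coords v → u ≡ v
  coords-injective {u} {v} eq =
    trans (sym (vertex-coords u)) (trans (cong (uncurry vertex) eq) (vertex-coords v))

  adjacentᵇ-sym : ∀ u v → T (adjacentᵇ u v) → T (adjacentᵇ v u)
  adjacentᵇ-sym u v p = adjacentᵇ⁺ v u (Adjacent-sym {coords u} {coords v} (adjacentᵇ⁻ u v p))

  chain : Graph
  chain = record
    { order   = k * V
    ; adj     = adjacentᵇ
    ; adj-sym = λ u v → T-ext (adjacentᵇ-sym u v) (adjacentᵇ-sym v u)
    ; adj-irr = λ v → T-ext (λ p → Adjacent-irr (coords v) (adjacentᵇ⁻ v v p)) λ ()
    }

  Adjacent⇒adj : ∀ i a j b → Adjacent (i , a) (j , b) → T (adjacentᵇ (vertex i a) (vertex j b))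
  Adjacent⇒adj i a j b p = adjacentᵇ⁺ _ _
    (subst₂ Adjacent (sym (coords-vertex i a)) (sym (coords-vertex j b)) p)

  Walk : Fin (k * V) → Fin (k * V) → Set
  Walk = Star (λ u v → T (adjacentᵇ u v))

  lift-over : ∀ {a} w → Petersen (over a) w → Petersen (over a) (over (lift w))
  lift-over {a} w = subst (Petersen (over a)) (sym (collapse-↑ˡ 9 s w))

  -- Inner adjacency depends only on the images under `over`, so any lift of a common neighbour in
  -- the Petersen graph is one here.
  gadget-diameter : ∀ i a b → Adjacent (i , a) (i , b)
                            ⊎ (∃[ c ] Adjacent (i , a) (i , c) × Adjacent (i , b) (i , c))
  gadget-diameter i a b with Petersen-diameter (over a) (over b)
  ... | inj₁ p           = inj₁ (inj₁ (refl , p))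
  ... | inj₂ (w , p , q) = inj₂ (lift w , inj₁ (refl , lift-over {a} w p) , inj₁ (refl , lift-over {b} w q))

  gadget-connected : ∀ i a b → Walk (vertex i a) (vertex i b)
  gadget-connected i a b with gadget-diameter i a b
  ... | inj₁ p           = Adjacent⇒adj i a i b p ◅ ε
  ... | inj₂ (c , p , q) = Adjacent⇒adj i a i c p
                         ◅ Adjacent⇒adj i c i b (Adjacent-sym {i , b} {i , c} q) ◅ ε

  -- Within each copy walk to `1F`, then take the link down to `0F` of the preceding copy. The
  -- recursion is on `n`, as `inject₁ i` is not a subterm of `suc i`.
  walk-to-root : ∀ n (i : Fin k) → toℕ i ≡ n → ∀ a → Walk (vertex i a) (vertex 0F 0F)
  walk-to-root zero    zero    _  a = gadget-connected 0F a 0F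
  walk-to-root (suc n) (suc i) eq a =
    gadget-connected (suc i) a 1F
    ◅◅ Adjacent⇒adj (suc i) 1F (inject₁ i) 0F (inj₂ (inj₂ (cong suc (sym (toℕ-inject₁ i)) , refl , refl)))
    ◅ walk-to-root n (inject₁ i) (trans (toℕ-inject₁ i) (suc-injective eq)) 0F

  chain-connected : Connected chain
  chain-connected = _ , λ u v → to-root u ◅◅ reverse (λ {u} {v} → adjacentᵇ-sym u v) (to-root v)
    where
    to-root : ∀ u → Walk u (vertex 0F 0F)
    to-root u = subst (λ w → Walk w (vertex 0F 0F)) (vertex-coords u)
      (walk-to-root _ (proj₁ (coords u)) refl (proj₂ (coords u)))

  -- Degrees and size of the chain.

  bound : Fin V → ℕ
  bound a = fixed (over a) + s * twinned (over a)

  sum-petersen : ∀ p → sum {V} (λ b → ι ⌊ petersen? p (over b) ⌋)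
                         ≡ sum (λ q → ι ⌊ petersen? p q ⌋) + s * twinned p
  sum-petersen p = sum-collapse 9 s (λ q → ι ⌊ petersen? p q ⌋)

  sum-inner : ∀ i a → sum (λ v → ι ⌊ inner? (i , a) (coords v) ⌋)
                      ≤ sum {V} (λ b → ι ⌊ petersen? (over a) (over b) ⌋)
  sum-inner i a = sum-fibre k (λ v → ⌊ inner? (i , a) (coords v) ⌋) (λ b → ⌊ petersen? (over a) (over b) ⌋) i
    λ j b p → let i≡j , q = subst (Inner (i , a)) (coords-vertex j b) (toWitness {a? = inner? (i , a) (coords (vertex j b))} p)
              in sym i≡j , fromWitness q

  -- `Up` prescribes both the copy and the hub of its target, so a link up is unique.
  sum-up : ∀ x → sum (λ v → ι ⌊ up? x (coords v) ⌋) ≤ ι ⌊ proj₂ x ≟ 0F ⌋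
  sum-up x = sum-ι≤ι (λ v → ⌊ up? x (coords v) ⌋)
    (λ v p → fromWitness (proj₁ (proj₂ (toWitness {a? = up? x (coords v)} p))))
    (λ u v p q → coords-injective (unique (toWitness p) (toWitness q)))
    where
    unique : ∀ {y z} → Up x y → Up x z → y ≡ z
    unique (e , _ , refl) (f , _ , refl) = cong (_, 1F) (toℕ-injective (trans e (sym f)))

  sum-down : ∀ x → sum (λ v → ι ⌊ up? (coords v) x ⌋) ≤ ι ⌊ proj₂ x ≟ 1F ⌋
  sum-down x = sum-ι≤ι (λ v → ⌊ up? (coords v) x ⌋)
    (λ v p → fromWitness (proj₂ (proj₂ (toWitness {a? = up? (coords v) x} p))))
    (λ u v p q → coords-injective (unique (toWitness p) (toWitness q)))
    where
    unique : ∀ {y z} → Up y x → Up z x → y ≡ z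
    unique (e , refl , _) (f , refl , _) = cong (_, 0F) (toℕ-injective (suc-injective (trans (sym e) f)))

  -- Both hubs lie before the twinned vertex, where `collapse` keeps indices apart.
  hub-over : ∀ a → ι ⌊ a ≟ 0F ⌋ + ι ⌊ a ≟ 1F ⌋ ≡ ι ⌊ over a ≟ 0F ⌋ + ι ⌊ over a ≟ 1F ⌋
  hub-over zero          = refl
  hub-over (suc zero)    = refl
  hub-over (suc (suc a)) = refl

  -- Union bound over inner neighbours, links up and links down. It is strict at the two hubs at the
  -- ends of the chain that lack a link.
  degree≤ : ∀ v → degree chain v ≤ bound (proj₂ (coords v))
  degree≤ v = begin
    degree chain v                                          ≡⟨ degree-sum chain v ⟩
    sum (λ w → ι (adjacentᵇ v w))                           ≤⟨ sum-mono split ⟩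
    sum (λ w → I w + (U w + D w))                           ≡⟨ ∑-distrib-+ I (λ w → U w + D w) ⟩
    sum I + sum (λ w → U w + D w)                           ≡⟨ cong (sum I +_) (∑-distrib-+ U D) ⟩
    sum I + (sum U + sum D)                                 ≤⟨ +-mono-≤ (sum-inner (proj₁ x) a) (+-mono-≤ (sum-up x) (sum-down x)) ⟩
    sum {V} (λ b → ι ⌊ petersen? (over a) (over b) ⌋) + (ι ⌊ a ≟ 0F ⌋ + ι ⌊ a ≟ 1F ⌋)
                                                            ≡⟨ cong₂ _+_ (sum-petersen (over a)) (hub-over a) ⟩
    (n + s * t) + h                                         ≡⟨ +-assoc n (s * t) h ⟩
    n + (s * t + h)                                         ≡⟨ cong (n +_) (+-comm (s * t) h) ⟩
    n + (h + s * t)                                         ≡⟨ +-assoc n h (s * t) ⟨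
    bound a                                                 ∎
    where
    open ≤-Reasoning
    x = coords v
    a = proj₂ x
    n = sum (λ q → ι ⌊ petersen? (over a) q ⌋)
    t = twinned (over a)
    h = ι ⌊ over a ≟ 0F ⌋ + ι ⌊ over a ≟ 1F ⌋
    I U D : Fin (k * V) → ℕ
    I w = ι ⌊ inner? x (coords w) ⌋
    U w = ι ⌊ up? x (coords w) ⌋
    D w = ι ⌊ up? (coords w) x ⌋
    split : ∀ w → ι (adjacentᵇ v w) ≤ I w + (U w + D w)
    split w = ι≤ {adjacentᵇ v w} λ p → case′ (adjacentᵇ⁻ v w p)
      where
      case′ : Adjacent x (coords w) → 1 ≤ I w + (U w + D w)
      case′ (inj₁ p)        = ≤-trans (T⇒1≤ι {⌊ inner? x (coords w) ⌋} (fromWitness p)) (m≤m+n _ _)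
      case′ (inj₂ (inj₁ p)) = ≤-trans (T⇒1≤ι {⌊ up? x (coords w) ⌋} (fromWitness p))
                                      (≤-trans (m≤m+n _ (D w)) (m≤n+m _ (I w)))
      case′ (inj₂ (inj₂ p)) = ≤-trans (T⇒1≤ι {⌊ up? (coords w) x ⌋} (fromWitness p))
                                      (≤-trans (m≤n+m _ (U w)) (m≤n+m _ (I w)))

  degree≤Δ : ∀ v → degree chain v ≤ 4 + s
  degree≤Δ v = begin
    degree chain v             ≤⟨ degree≤ v ⟩
    fixed p + s * twinned p    ≤⟨ +-mono-≤ (fixed≤4 p) (*-monoʳ-≤ s (twinned≤1 p)) ⟩
    4 + s * 1                  ≡⟨ cong (4 +_) (*-identityʳ s) ⟩
    4 + s                      ∎
    where
    open ≤-Reasoning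
    p = over (proj₂ (coords v))

  root : Fin (k * V)
  root = vertex 0F 0F

  -- One of the three Petersen neighbours of `0F` is the twinned vertex, which gives `3 + s`
  -- neighbours in row `0F`; row `1F` contributes the link.
  Δ≤degree : 4 + s ≤ degree chain root
  Δ≤degree = begin
    4 + s                                            ≡⟨ lemma s ⟩
    3 + s * 1 + 1                                    ≡⟨ cong (_+ 1) (sum-petersen 0F) ⟨
    sum inner + 1                                    ≤⟨ +-mono-≤ (sum-mono inner≤row)
                                                          (≤-trans (T⇒1≤ι link) (term≤sum (row 1F) 1F)) ⟩
    sum (row 0F) + sum (row 1F)                      ≤⟨ +-monoʳ-≤ (sum (row 0F)) (m≤m+n _ _) ⟩
    sum (λ j → sum (row j))                          ≡⟨ sum-combine k {V} (ι ∘ adjacentᵇ root) ⟨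
    sum (ι ∘ adjacentᵇ root)                         ≡⟨ degree-sum chain root ⟨
    degree chain root                                ∎
    where
    open ≤-Reasoning
    inner : Fin V → ℕ
    inner b = ι ⌊ petersen? 0F (over b) ⌋
    row : Fin k → Fin V → ℕ
    row j b = ι (adjacentᵇ root (vertex j b))
    inner≤row : ∀ b → inner b ≤ row 0F b
    inner≤row b = ι≤ {⌊ petersen? 0F (over b) ⌋} λ p →
      T⇒1≤ι (Adjacent⇒adj 0F 0F 0F b (inj₁ (refl , toWitness {a? = petersen? 0F (over b)} p)))
    link : T (adjacentᵇ root (vertex 1F 1F))
    link = Adjacent⇒adj 0F 0F 1F 1F (inj₂ (inj₁ (refl , refl , refl)))
    lemma : ∀ s → 4 + s ≡ 3 + s * 1 + 1
    lemma = solve-∀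

  chain-maxDegree : maxDegree chain ≡ 4 + s
  chain-maxDegree = maxDegree-≡ chain degree≤Δ root Δ≤degree

  -- Each further twin adds 3 for its own degree and 1 to each of its three neighbours. The
  -- quadratic term vanishes because twins are nonadjacent.
  sum-bound : sum bound ≡ 32 + 6 * s
  sum-bound = trans (sum-collapse-affine 9 s fixed twinned) (evaluate sum-fixed sum-twinned fixed-9 twinned-9)
    where
    evaluate : ∀ {a b c d} → a ≡ 32 → b ≡ 3 → c ≡ 3 → d ≡ 0 → a + s * b + s * (c + s * d) ≡ 32 + 6 * s
    evaluate refl refl refl refl = lemma 32 s
      where
      lemma : ∀ a s → a + s * 3 + s * (3 + s * 0) ≡ a + 6 * s
      lemma = solve-∀

  2size≤ : 2 * size chain ≤ k * (32 + 6 * s)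
  2size≤ = begin
    2 * size chain                                               ≤⟨ 2size≤degree-sum chain ⟩
    sum (degree chain)                                           ≤⟨ sum-mono degree≤ ⟩
    sum (λ v → bound (proj₂ (coords v)))                         ≡⟨ sum-combine k {V} (λ v → bound (proj₂ (coords v))) ⟩
    sum {k} (λ i → sum {V} (λ a → bound (proj₂ (coords (vertex i a)))))
      ≡⟨ sum-cong-≗ (λ i → trans (sum-cong-≗ (λ a → cong (bound ∘ proj₂) (coords-vertex i a))) sum-bound) ⟩
    sum {k} (λ _ → 32 + 6 * s)                                   ≡⟨ sum-const k (32 + 6 * s) ⟩
    k * (32 + 6 * s)                                             ∎
    where open ≤-Reasoning

  -- At most one vertex per gadget lies outside the cover.

  module _ {S : Subset (k * V)} (ivc : IdentifyingVertexCover chain S) where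

    -- Of the two cases of `gadget-diameter`, adjacency would leave an edge uncovered, and a common
    -- neighbour forces equality by the identifying condition.
    missing-unique : ∀ i a b → vertex i a Subset.∉ S → vertex i b Subset.∉ S → a ≡ b
    missing-unique i a b a∉ b∉ with gadget-diameter i a b
    ... | inj₁ p           = ⊥-elim (uncovered-edge chain ivc a∉ b∉ (Adjacent⇒adj i a i b p))
    ... | inj₂ (c , p , q) = proj₂ (combine-injective i a i b
      (common-neighbour chain ivc a∉ b∉ (Adjacent⇒adj i a i c p) (Adjacent⇒adj i b i c q)))

    member : Fin k → Fin V → Bool
    member i a = lookup S (vertex i a)

    not-member⇒∉ : ∀ i a → T (not (member i a)) → vertex i a Subset.∉ S
    not-member⇒∉ i a p a∈ = subst (T ∘ not) (Vec.[]=⇒lookup a∈) p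

    gadget-count : ∀ i → 9 + s ≤ sum (ι ∘ member i)
    gadget-count i = +-cancelʳ-≤ 1 (9 + s) _ (begin
      9 + s + 1                                                 ≡⟨ +-comm (9 + s) 1 ⟩
      V                                                         ≡⟨ *-identityʳ V ⟨
      V * 1                                                     ≡⟨ sum-const V 1 ⟨
      sum {V} (λ _ → 1)                                         ≡⟨ sum-cong-≗ (λ a → ι-not (member i a)) ⟨
      sum (λ a → ι (member i a) + ι (not (member i a)))         ≡⟨ ∑-distrib-+ (ι ∘ member i) (ι ∘ not ∘ member i) ⟩
      sum (ι ∘ member i) + sum (ι ∘ not ∘ member i)             ≤⟨ +-monoʳ-≤ _ at-most-one-missing ⟩
      sum (ι ∘ member i) + 1                                    ∎)
      where
      open ≤-Reasoning
      at-most-one-missing : sum (ι ∘ not ∘ member i) ≤ 1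
      at-most-one-missing = sum-ι≤ι (not ∘ member i) {true} (λ _ _ → _)
        (λ a b p q → missing-unique i a b (not-member⇒∉ i a p) (not-member⇒∉ i b q))

    IVC-size : k * (9 + s) ≤ ∣ S ∣
    IVC-size = begin
      k * (9 + s)                         ≡⟨ sum-const k (9 + s) ⟨
      sum {k} (λ _ → 9 + s)               ≤⟨ sum-mono gadget-count ⟩
      sum (λ i → sum (ι ∘ member i))      ≡⟨ sum-combine k {V} (ι ∘ lookup S) ⟨
      sum (ι ∘ lookup S)                  ≡⟨ ∣tabulate∣ (lookup S) ⟨
      ∣ tabulate (lookup S) ∣             ≡⟨ cong ∣_∣ (Vec.tabulate∘lookup S) ⟩
      ∣ S ∣                               ∎
      where open ≤-Reasoning

  τD≥ : k * (9 + s) ≤ τD chain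
  τD≥ = ≤-τD chain λ S → IVC-size

-- Comparing rationals with natural numbers.

open import Data.Integer.Base using (+_; -[1+_]; +≤+; -≤+)

toℚᵘ-/ : ∀ i d → toℚᵘ (i / suc d) ℚᵘ.≃ ℚᵘ.mkℚᵘ i d
toℚᵘ-/ i d = ℚ.toℚᵘ-fromℚᵘ (ℚᵘ.mkℚᵘ i d)

/-≤ : ∀ a d t → a ℕ.≤ t ℕ.* suc d → + a / suc d ℚ.≤ ℕ→ℚ t
/-≤ a d t a≤td = ℚ.toℚᵘ-cancel-≤ (begin
  toℚᵘ (+ a / suc d)     ≃⟨ toℚᵘ-/ (+ a) d ⟩
  ℚᵘ.mkℚᵘ (+ a) d        ≤⟨ ℚᵘ.*≤* (subst₂ ℤ._≤_ (sym (ℤ.*-identityʳ (+ a))) (ℤ.pos-* t (suc d)) (+≤+ a≤td)) ⟩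
  ℚᵘ.mkℚᵘ (+ t) 0        ≃⟨ toℚᵘ-/ (+ t) 0 ⟨
  toℚᵘ (ℕ→ℚ t)           ∎)
  where open ℚᵘ.≤-Reasoning

ℕ→ℚ-cancel-< : ∀ {m n} → ℕ→ℚ m ℚ.< ℕ→ℚ n → m ℕ.< n
ℕ→ℚ-cancel-< {m} {n} m<n with
  ℚᵘ.*<* p ← ℚᵘ.<-respʳ-≃ (toℚᵘ-/ (+ n) 0) (ℚᵘ.<-respˡ-≃ (toℚᵘ-/ (+ m) 0) (ℚ.toℚᵘ-mono-< m<n))
  = ℤ.drop‿+<+ (subst₂ ℤ._<_ (ℤ.*-identityʳ (+ m)) (ℤ.*-identityʳ (+ n)) p)

ℕ→ℚ-+ : ∀ m n → ℕ→ℚ (m ℕ.+ n) ≡ ℕ→ℚ m ℚ.+ ℕ→ℚ n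
ℕ→ℚ-+ m n = ℚ.toℚᵘ-injective (begin-equality
  toℚᵘ (ℕ→ℚ (m ℕ.+ n))                 ≃⟨ toℚᵘ-/ (+ (m ℕ.+ n)) 0 ⟩
  ℚᵘ.mkℚᵘ (+ (m ℕ.+ n)) 0              ≃⟨ ℚᵘ.*≡* (cong (ℤ._* + 1) (cong₂ ℤ._+_ (sym (ℤ.*-identityʳ (+ m))) (sym (ℤ.*-identityʳ (+ n))))) ⟩
  ℚᵘ.mkℚᵘ (+ m) 0 ℚᵘ.+ ℚᵘ.mkℚᵘ (+ n) 0 ≃⟨ ℚᵘ.+-cong (toℚᵘ-/ (+ m) 0) (toℚᵘ-/ (+ n) 0) ⟨
  toℚᵘ (ℕ→ℚ m) ℚᵘ.+ toℚᵘ (ℕ→ℚ n)       ≃⟨ ℚ.toℚᵘ-homo-+ (ℕ→ℚ m) (ℕ→ℚ n) ⟨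
  toℚᵘ (ℕ→ℚ m ℚ.+ ℕ→ℚ n)               ∎)
  where open ℚᵘ.≤-Reasoning

-- The denominator is at least 1, so `p` is at most the absolute value of its numerator.
archimedean : ∀ p → p ℚ.< ℕ→ℚ (suc ℤ.∣ ℚ.↥ p ∣)
archimedean p@(mkℚ i d _) = ℚ.toℚᵘ-cancel-< (ℚᵘ.<-respʳ-≃ (ℚᵘ.≃-sym (toℚᵘ-/ (+ suc ℤ.∣ i ∣) 0)) (ℚᵘ.*<* (begin-strict
  i ℤ.* + 1                        ≡⟨ ℤ.*-identityʳ i ⟩
  i                                ≤⟨ i≤∣i∣ i ⟩
  + ℤ.∣ i ∣                        <⟨ ℤ.+<+ (ℕ.n<1+n _) ⟩
  + suc ℤ.∣ i ∣                    ≤⟨ +≤+ (ℕ.m≤m*n (suc ℤ.∣ i ∣) (suc d)) ⟩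
  + (suc ℤ.∣ i ∣ ℕ.* suc d)        ≡⟨ ℤ.pos-* (suc ℤ.∣ i ∣) (suc d) ⟩
  + suc ℤ.∣ i ∣ ℤ.* + suc d        ∎)))
  where
  open ℤ.≤-Reasoning
  i≤∣i∣ : ∀ i → i ℤ.≤ + ℤ.∣ i ∣
  i≤∣i∣ (+ n)    = ℤ.≤-refl
  i≤∣i∣ -[1+ n ] = -≤+

-- Were the quotient `q` below `z`, then `q + 1` would be at most `z`, and the numerator, being less
-- than `(q + 1) * d`, would be less than `z * d`.
floor-≥ : ∀ z p → z ℤ.* ℚ.↧ p ℤ.≤ ℚ.↥ p → z ℤ.≤ ℚ.floor p
floor-≥ z p@(mkℚ n d _) zd≤n = subst (z ℤ.≤_) (sym (ℤ.div-pos-is-/ℕ n (suc d)))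
  (ℤ.≮⇒≥ λ q<z → ℤ.<⇒≱ (ℤ.n<s[n/ℕd]*d n (suc d))
    (ℤ.≤-trans (ℤ.*-monoʳ-≤-nonNeg (+ suc d) (ℤ.i<j⇒suc[i]≤j q<z)) zd≤n))

-- The ceiling is the negated floor of `- p`, so this is `floor-≥` at `- t`.
ceiling-≤ : ∀ p t → p ℚ.≤ ℕ→ℚ t → ⌈ p ⌉ ℤ.≤ + t
ceiling-≤ p@record{} t p≤t
  with ℚᵘ.*≤* n≤td ← ℚᵘ.≤-respʳ-≃ (toℚᵘ-/ (+ t) 0) (ℚ.toℚᵘ-mono-≤ p≤t)
  = subst (⌈ p ⌉ ℤ.≤_) (ℤ.neg-involutive (+ t)) (ℤ.neg-mono-≤ (floor-≥ (ℤ.- + t) (ℚ.- p) (begin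
      ℤ.- + t ℤ.* ℚ.↧ (ℚ.- p)   ≡⟨ cong (ℤ.- + t ℤ.*_) (ℚ.↧-neg p) ⟩
      ℤ.- + t ℤ.* ℚ.↧ p         ≡⟨ ℤ.neg-distribˡ-* (+ t) (ℚ.↧ p) ⟨
      ℤ.- (+ t ℤ.* ℚ.↧ p)       ≤⟨ ℤ.neg-mono-≤ (subst (ℤ._≤ + t ℤ.* ℚ.↧ p) (ℤ.*-identityʳ (ℚ.↥ p)) n≤td) ⟩
      ℤ.- ℚ.↥ p                 ≡⟨ ℚ.↥-neg p ⟨
      ℚ.↥ (ℚ.- p)               ∎)))
  where open ℤ.≤-Reasoning

-- The excess over the bound, and its consequences.

BHY-≤ : ∀ G {Δ m} t → maxDegree G ≡ Δ → 2 * size G ≤ m →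
        Δ * (Δ ∸ 1) * Graph.order G + m ≤ t * suc (Δ ^ 2) → BHY G ℚ.≤ ℕ→ℚ t
BHY-≤ G t refl 2size≤m h = /-≤ _ _ t (≤-trans (+-monoʳ-≤ _ 2size≤m) h)

opaque

  -- A copy adds `9 + s` to the lower bound for `τD` and at most `c / d` to `BHY`, a gain of at
  -- least `(1 + s) / d`. The natural number `t` separates the two quantities, so it serves the
  -- additive constant and the ceiling alike.
  excess : ∀ s N → Σ[ G ∈ Graph ] Connected G × maxDegree G ≡ 4 + s ×
           Σ[ t ∈ ℕ ] BHY G ℚ.≤ ℕ→ℚ t × t + N ≤ τD G
  excess s N = chain , chain-connected , chain-maxDegree , t
    , BHY-≤ chain t chain-maxDegree 2size≤ (≤-trans (≤-reflexive (regroup ((4 + s) * (3 + s)) k V _)) numerator≤)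
    , ≤-trans (≤-reflexive (m∸n+n≡m N≤)) τD≥
    where
    d : ℕ
    d = suc ((4 + s) ^ 2)
    -- Each copy gains at least `1 / d`, so `N * d` copies gain `N`.
    open Chain s (N * d)
    t c : ℕ
    -- The subtraction is not truncated, by `N≤`.
    t = k * (9 + s) ∸ N
    c = (4 + s) * (3 + s) * (10 + s) + (32 + 6 * s)
    Nd≤k : N * d ≤ k
    Nd≤k = m≤n+m (N * d) 2
    N≤ : N ≤ k * (9 + s)
    N≤ = ≤-trans (m≤m*n N d) (≤-trans Nd≤k (m≤m*n k (9 + s)))
    regroup : ∀ a k n c → a * (k * n) + k * c ≡ k * (a * n + c)
    regroup = solve-∀
    -- The decisive identity: `(9 + s) * d` exceeds the numerator `c` of one copy by `1 + s`. The
    -- factor `(4 + s) * 1` is the unfolded square.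
    weight : ∀ s → (9 + s) * (1 + (4 + s) * ((4 + s) * 1)) ≡ (4 + s) * (3 + s) * (10 + s) + (32 + 6 * s) + (1 + s)
    weight = solve-∀
    open ≤-Reasoning
    numerator≤ : k * c ≤ t * d
    numerator≤ = begin
      k * c                            ≡⟨ m+n∸n≡m (k * c) (N * d) ⟨
      k * c + N * d ∸ N * d            ≤⟨ ∸-monoˡ-≤ (N * d) (+-monoʳ-≤ (k * c) (≤-trans Nd≤k (m≤m*n k (1 + s)))) ⟩
      k * c + k * (1 + s) ∸ N * d      ≡⟨ cong (_∸ N * d) (*-distribˡ-+ k c (1 + s)) ⟨
      k * (c + (1 + s)) ∸ N * d        ≡⟨ cong (λ w → k * w ∸ N * d) (weight s) ⟨
      k * ((9 + s) * d) ∸ N * d        ≡⟨ cong (_∸ N * d) (*-assoc k (9 + s) d) ⟨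
      k * (9 + s) * d ∸ N * d          ≡⟨ *-distribʳ-∸ d (k * (9 + s)) N ⟨
      t * d                            ∎

bound-exceeded : ∀ τ t p C → p ℚ.≤ ℕ→ℚ t → t + suc ℤ.∣ ℚ.↥ C ∣ ≤ τ → ¬ (ℕ→ℚ τ ℚ.≤ p ℚ.+ C)
bound-exceeded τ t p C p≤t t+N≤τ τ≤p+C = <⇒≱ (ℕ→ℚ-cancel-< {τ} {t + N} (begin-strict
  ℕ→ℚ τ               ≤⟨ τ≤p+C ⟩
  -- `N` is chosen as a natural number strictly above `C`.
  p ℚ.+ C             <⟨ ℚ.+-mono-≤-< p≤t (archimedean C) ⟩
  ℕ→ℚ t ℚ.+ ℕ→ℚ N     ≡⟨ ℕ→ℚ-+ t N ⟨
  ℕ→ℚ (t + N)         ∎)) t+N≤τ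
  where
  open ℚ.≤-Reasoning
  N : ℕ
  N = suc ℤ.∣ ℚ.↥ C ∣

unbounded : ∀ s C → Σ[ G ∈ Graph ] Connected G × maxDegree G ≡ 4 + s × ¬ (ℕ→ℚ (τD G) ℚ.≤ BHY G ℚ.+ C)
unbounded s C =
  let G , connected , Δ≡ , t , BHY≤t , t+N≤τ = excess s (suc ℤ.∣ ℚ.↥ C ∣)
  in  G , connected , Δ≡ , bound-exceeded (τD G) t (BHY G) C BHY≤t t+N≤τ

ceiling-exceeded : Σ[ G ∈ Graph ] (⌈ BHY G ⌉ ℤ.< (ℤ.+ τD G))
ceiling-exceeded =
  -- An excess of 1 suffices, because `t` is an integer and so bounds the ceiling of `BHY G` as
  -- well.
  let G , _ , _ , t , BHY≤t , t+1≤τ = excess 0 1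
  in  G , ℤ.≤-<-trans (ceiling-≤ (BHY G) t BHY≤t) (ℤ.+<+ (≤-trans (≤-reflexive (+-comm 1 t)) t+1≤τ))

corollary4p7 : ((Δ : ℕ) → 4 ℕ.≤ Δ →
    ¬ (Σ[ C ∈ ℚ ] ((G : Graph) → Connected G → maxDegree G ≡ Δ →
    ℕ→ℚ (τD G) ℚ.≤ BHY G ℚ.+ C)))
    × ¬ (Σ[ C ∈ ℚ ] ((G : Graph) → ℕ→ℚ (τD G) ℚ.≤ BHY G ℚ.+ C))
    × ¬ ((G : Graph) → (+ τD G) ℤ.≤ ⌈ BHY G ⌉)
    × (Σ[ G ∈ Graph ] (⌈ BHY G ⌉ ℤ.< (+ τD G)))
corollary4p7 =
    (λ { .(4 + s) (s≤s (s≤s (s≤s (s≤s (z≤n {s}))))) (C , bounded) →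
         let G , connected , Δ≡ , exceeds = unbounded s C in exceeds (bounded G connected Δ≡) })
  -- A bound for all graphs would in particular hold for the connected ones of maximum degree 4.
  , (λ (C , bounded) → let G , _ , _ , exceeds = unbounded 0 C in exceeds (bounded G))
  , (λ bounded → let G , exceeds = ceiling-exceeded in ℤ.<⇒≱ exceeds (bounded G))
  , ceiling-exceeded
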